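{- Let $G$ be a graph and let $\mathcal T$ be the collection of PSD forcing trees (the forcing tree cover) for some PSD forcing set of $G$ of size $k$ (with respect to some relaxed chronology of PSD forces). For any $v\in V(G)$, there exist a PSD forcing set $B$ of $G$ of size $k$ containing $v$ and a relaxed chronology of PSD forces for $B$ on $G$ whose collection of forcing trees is $\mathcal T$.
   Context: All graphs are finite, simple and undirected. Each vertex is blue or white. PSD rule: if $B$ is the current set of blue vertices, $C$ is a component of $G-B$, and $u\in B$ satisfies $N_G(u)\cap V(C)=\{v\}$, then $u$ can force $v$ to become blue ($u\to v$). $B$ is a PSD forcing set if, starting with exactly $B$ blue, repeated forcing turns all vertices blue. $S_+(G,B)$ is the set of PSD forces $v\to u$ valid when exactly $B$ is blue. Relaxed chronology of PSD forces for a PSD forcing set $B$ on $G$: an ordered family $\mathcal F=\{F^{(k)}\}_{k=1}^K$ of sets of forces ($F^{(k)}=\emptyset$ allowed) such that, with $E^{[0]}=E^{(0)}=B$, $E^{(k)}=\{u: v\to u\in F^{(k)}\text{ for some }v\}$, $E^{[k]}=\bigcup_{j=0}^kE^{(j)}$: (1) $F^{(k)}\subseteq S_+(G,E^{[k-1]})$ for all $k$; (2) $v_1\to u,v_2\to u\in F^{(k)}$ implies $v_1=v_2$; (3) $E^{[K]}=V(G)$. Forcing trees: for $b\in B$ let $V_b$ be the set of vertices $w$ for which there is a (possibly empty) sequence of forces $b=v_1\to v_2\to\dots\to v_\ell=w$ in $\bigcup_kF^{(k)}$; the forcing tree is $T_b=G[V_b]$, and the forcing tree cover is $\{T_b:b\in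 B\}$. -}

module Defs where

open import Data.Fin.Base using (Fin; toℕ)
open import Data.Fin.Subset using (Subset; _∈_; _∉_; ⊤; ⁅_⁆; _∪_; ⋃)
open import Data.List.Base using (List; length; lookup; take; map; tabulate)
import Data.List.Membership.Propositional as List
open import Data.Nat.Base using (ℕ)
open import Data.Product.Base using (_×_; _,_; ∃-syntax)
open import Level using (0ℓ) renaming (suc to lsuc)
open import Relation.Binary.Core using (Rel; _⇔_)
open import Relation.Binary.Construct.Closure.ReflexiveTransitive using (Star)
open import Relation.Binary.PropositionalEquality using (_≡_)
open import Relation.Unary using (Pred; _≐_; ｛_｝) renaming (_∩_ to _∩ᵖ_)

-- Vertices are Fin n; N u is the open neighbourhood of u, so adjacency is
-- decidable.
record Graph (n : ℕ) : Set where
  field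
    N         : Fin n → Subset n
    symmetric : ∀ {u v} → v ∈ N u → u ∈ N v
    loopless  : ∀ {u} → u ∉ N u

record Subgraph {n : ℕ} (G : Graph n) : Set (lsuc 0ℓ) where
  open Graph G using (N)
  field
    V     : Pred (Fin n) 0ℓ
    E     : Rel (Fin n) 0ℓ
    E⇒V   : ∀ {u v} → E u v → V u × V v
    E⇒adj : ∀ {u v} → E u v → v ∈ N u
    E-sym : ∀ {u v} → E u v → E v u

open Subgraph public using (V; E)

module _ {n : ℕ} {G : Graph n} where

  -- Same vertex set and same edge set (equality, not isomorphism).
  infix 4 _≈_
  _≈_ : Rel (Subgraph G) 0ℓ
  H ≈ H′ = V H ≐ V H′ × E H ⇔ E H′

  -- Vertex set of the component of H containing x, for x a vertex of H.
  Component : Subgraph G → Fin n → Pred (Fin n) 0ℓ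
  Component H x = Star (E H) x

module _ {n : ℕ} (G : Graph n) where
  open Graph G

  -- The induced subgraph G[ W ].
  induced : Pred (Fin n) 0ℓ → Subgraph G
  induced W = record
    { V     = W
    ; E     = λ u v → W u × W v × v ∈ N u
    ; E⇒V   = λ (wu , wv , _) → wu , wv
    ; E⇒adj = λ (_ , _ , uv) → uv
    ; E-sym = λ (wu , wv , uv) → wv , wu , symmetric uv
    }

  -- G − B
  delete : Subset n → Subgraph G
  delete B = induced (_∉ B)

  -- S₊ B u v : the force u → v is valid when exactly B is blue.  A component
  -- of G − B is given by one of its vertices x.
  S₊ : Subset n → Rel (Fin n) 0ℓ
  S₊ B u v =
    u ∈ B ×
    ∃[ x ] (V (delete B) x ×
            ((_∈ N u) ∩ᵖ Component (delete B) x) ≐ ｛ v ｝)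

  -- One force is performed.
  Step : Rel (Subset n) 0ℓ
  Step B B′ = ∃[ u ] ∃[ v ] (S₊ B u v × B′ ≡ B ∪ ⁅ v ⁆)

  IsPSDForcingSet : Pred (Subset n) 0ℓ
  IsPSDForcingSet B = Star Step B ⊤

-- A set F of forces, where u ∈ F v means that v → u belongs to F.
ForceSet : ℕ → Set
ForceSet n = Fin n → Subset n

targets : ∀ {n} → ForceSet n → Subset n
targets F = ⋃ (tabulate F)

record RelaxedChronology {n : ℕ} (G : Graph n) (B : Subset n) : Set where
  field
    -- F⁽¹⁾ , … , F⁽ᴷ⁾ with K = length forces; entries may be empty.
    forces : List (ForceSet n)

  -- E^[k], the blue vertices after k time-steps.
  blue : ℕ → Subset n
  blue k = B ∪ ⋃ (map targets (take k forces))

  field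
    -- Position i, counted from 0, holds F⁽ⁱ⁺¹⁾, to be compared with E^[i].
    valid    : ∀ (i : Fin (length forces)) {v u} →
               u ∈ lookup forces i v → S₊ G (blue (toℕ i)) v u
    unique   : ∀ (i : Fin (length forces)) {v₁ v₂ u} →
               u ∈ lookup forces i v₁ → u ∈ lookup forces i v₂ → v₁ ≡ v₂
    complete : blue (length forces) ≡ ⊤

  -- v → u occurs in ⋃ₖ F⁽ᵏ⁾.
  Force : Rel (Fin n) 0ℓ
  Force v u = ∃[ F ] (F List.∈ forces × u ∈ F v)

  forcingTree : Fin n → Subgraph G
  forcingTree b = induced G (Star Force b)

  -- The set { T_b : b ∈ B } of subgraphs of G.
  forcingTreeCover : Pred (Subgraph G) 0ℓ
  forcingTreeCover H = ∃[ b ] (b ∈ B × H ≈ forcingTree b)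

open RelaxedChronology public using (forcingTreeCover)

{-# OPTIONS --safe #-}
-- Colour every vertex by the root of its forcing tree.  A set B that has one
-- vertex of each colour, and from which V(G) can be forced by forces between
-- vertices of equal colour, has the colour classes as its forcing trees.  So
-- it suffices to move such a set towards v, keeping the colouring.
--
-- If v ∉ B, then some force u → w is valid already for B, with w in the
-- component of v in G − B: take the first force into that component, which
-- the earlier forces leave unchanged.  Replace u by w in B.  Now w → u is
-- valid, and after it B ∪ {w} is blue, so the new set is forcing as well.
-- Since w is the only neighbour of u in the component of v, the new component
-- of v is contained in the old one and misses w; hence this terminates.
module Submission where

open import Defs
open import Data.Empty using (⊥-elim)
open import Data.Fin.Base using (Fin; zero; suc; toℕ; _<_)
open import Data.Fin.Induction using (>-weakInduction)
open import Data.Fin.Properties using (_≟_; any?; <-cmp; toℕ-fromℕ; toℕ-inject₁)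
open import Data.Fin.Subset using (Subset; inside; outside; _∈_; _∉_; _⊆_; _⊂_; _⊃_; ⊤; ⊥; ⁅_⁆; _∪_; _-_; ⋃; ∣_∣)
open import Data.Fin.Subset.Induction using (Acc; acc; ⊂-wellFounded; ⊃-wellFounded)
open import Data.Fin.Subset.Properties
open import Data.List.Base using (List; []; _∷_; length; lookup; take; map; tabulate)
open import Data.List.Membership.Propositional.Properties using (∈-lookup)
open import Data.List.Relation.Unary.Any as Any using (Any; here; there)
open import Data.List.Relation.Unary.Any.Properties using (lookup-index; tabulate⁺; tabulate⁻)
open import Data.Nat.Base using (ℕ; suc; s<s)
open import Data.Product.Base using (_×_; _,_; proj₁; proj₂; Σ-syntax; ∃-syntax)
open import Data.Sum.Base using (_⊎_; inj₁; inj₂; [_,_]′)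
open import Data.Vec.Base using (_∷_; here; there)
open import Function.Base using (id; _∘_; flip)
open import Level using (0ℓ)
open import Relation.Binary.Construct.Closure.ReflexiveTransitive as Star
  using (Star; ε; _◅_; _◅◅_; return; reverse)
open import Relation.Binary.Core using (Rel)
open import Relation.Binary.Definitions using (Decidable; tri<; tri≈; tri>)
open import Relation.Binary.PropositionalEquality
open import Relation.Nullary using (¬_; Dec; yes; no; ¬?; contradiction; _×-dec_)
open import Relation.Nullary.Decidable using (map′; decidable-stable)
open import Relation.Unary using (Pred; _≐_)
open import Relation.Unary.Properties using (≐-trans; ≐-sym)

private
  variable
    n : ℕ

-- Finite subsets: inserting, removing, and unions of lists.

x∉p-x : ∀ (p : Subset n) x → x ∉ p - x
x∉p-x (_ ∷ p) (suc x) x∈ = x∉p-x p x (drop-there x∈)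

∣p∪⁅x⁆∣≡1+∣p∣ : ∀ (p : Subset n) {x} → x ∉ p → ∣ p ∪ ⁅ x ⁆ ∣ ≡ suc ∣ p ∣
∣p∪⁅x⁆∣≡1+∣p∣ (inside  ∷ p) {zero}  x∉p = contradiction here x∉p
∣p∪⁅x⁆∣≡1+∣p∣ (outside ∷ p) {zero}  x∉p = cong (suc ∘ ∣_∣) (∪-identityʳ p)
∣p∪⁅x⁆∣≡1+∣p∣ (inside  ∷ p) {suc x} x∉p = cong suc (∣p∪⁅x⁆∣≡1+∣p∣ p (x∉p ∘ there))
∣p∪⁅x⁆∣≡1+∣p∣ (outside ∷ p) {suc x} x∉p = ∣p∪⁅x⁆∣≡1+∣p∣ p (x∉p ∘ there)

∣p∣≡1+∣p-x∣ : ∀ {p : Subset n} {x} → x ∈ p → ∣ p ∣ ≡ suc ∣ p - x ∣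
∣p∣≡1+∣p-x∣ {p = inside  ∷ p} here        = cong (suc ∘ ∣_∣) (sym (p─⊥≡p p))
∣p∣≡1+∣p-x∣ {p = inside  ∷ p} (there x∈p) = cong suc (∣p∣≡1+∣p-x∣ x∈p)
∣p∣≡1+∣p-x∣ {p = outside ∷ p} (there x∈p) = ∣p∣≡1+∣p-x∣ x∈p

x∈p∪⁅x⁆ : ∀ (p : Subset n) x → x ∈ p ∪ ⁅ x ⁆
x∈p∪⁅x⁆ p x = q⊆p∪q p ⁅ x ⁆ (x∈⁅x⁆ x)

x∈p∪⁅y⁆⁻ : ∀ (p : Subset n) {x y} → x ∈ p ∪ ⁅ y ⁆ → x ∈ p ⊎ x ≡ y
x∈p∪⁅y⁆⁻ p {y = y} x∈ with x∈p∪q⁻ p ⁅ y ⁆ x∈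
... | inj₁ x∈p = inj₁ x∈p
... | inj₂ x∈y = inj₂ (x∈⁅y⁆⇒x≡y y x∈y)

∪⁅⁆-least : ∀ {p q : Subset n} {x} → p ⊆ q → x ∈ q → p ∪ ⁅ x ⁆ ⊆ q
∪⁅⁆-least {p = p} p⊆q x∈q y∈ with x∈p∪⁅y⁆⁻ p y∈
... | inj₁ y∈p  = p⊆q y∈p
... | inj₂ refl = x∈q

p⊂p∪⁅x⁆ : ∀ {p : Subset n} {x} → x ∉ p → p ⊂ p ∪ ⁅ x ⁆
p⊂p∪⁅x⁆ {p = p} {x} x∉p = p⊆p∪q ⁅ x ⁆ , x , x∈p∪⁅x⁆ p x , x∉p

⋃⁺ : ∀ {ps : List (Subset n)} {x} → Any (x ∈_) ps → x ∈ ⋃ ps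
⋃⁺ {ps = _ ∷ ps} (here x∈p) = p⊆p∪q (⋃ ps) x∈p
⋃⁺ {ps = p ∷ ps} (there x∈) = q⊆p∪q p (⋃ ps) (⋃⁺ x∈)

⋃⁻ : ∀ (ps : List (Subset n)) {x} → x ∈ ⋃ ps → Any (x ∈_) ps
⋃⁻ []       x∈ = ⊥-elim (∉⊥ x∈)
⋃⁻ (p ∷ ps) x∈ with x∈p∪q⁻ p (⋃ ps) x∈
... | inj₁ x∈p  = here x∈p
... | inj₂ x∈ps = there (⋃⁻ ps x∈ps)

module _ {A : Set} (f : A → Subset n) where

  -- One time-step of `blue`: passing from E^[i] to E^[i+1] adds exactly the targets at position
  -- `i`.
  ⋃-take-suc : ∀ xs (i : Fin (length xs)) →
    ⋃ (map f (take (suc (toℕ i)) xs)) ≡ ⋃ (map f (take (toℕ i) xs)) ∪ f (lookup xs i)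
  ⋃-take-suc (x ∷ xs) zero    = ∪-comm (f x) ⊥
  ⋃-take-suc (x ∷ xs) (suc i) =
    trans (cong (f x ∪_) (⋃-take-suc xs i)) (sym (∪-assoc (f x) _ _))

  -- Positions count from 0, so the first `j` entries include position `i` as soon as `i < j`. For
  -- chronologies: what is forced at position `i` is already blue when position `j` is due.
  lookup⊆⋃-take : ∀ xs {i j : Fin (length xs)} → i < j →
    f (lookup xs i) ⊆ ⋃ (map f (take (toℕ j) xs))
  lookup⊆⋃-take (x ∷ xs) {zero}  {suc j} _         = p⊆p∪q _
  lookup⊆⋃-take (x ∷ xs) {suc i} {suc j} (s<s i<j) = q⊆p∪q (f x) _ ∘ lookup⊆⋃-take xs i<j

targets⁺ : ∀ (F : ForceSet n) {v u} → u ∈ F v → u ∈ targets F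
targets⁺ F {v} u∈Fv = ⋃⁺ (tabulate⁺ v u∈Fv)

targets⁻ : ∀ (F : ForceSet n) {u} → u ∈ targets F → ∃[ v ] u ∈ F v
targets⁻ F u∈ = tabulate⁻ (⋃⁻ (tabulate F) u∈)

-- Deciding reachability in a finite relation.

module _ {R : Rel (Fin n) 0ℓ} (R? : Decidable R) (x : Fin n) where

  private
    -- Saturation: while some `R`-step leaves `W`, its endpoint is added, which stops by finiteness.
    -- A closed `W` containing `x` holds everything reachable from `x`, so membership in `W` decides
    -- reachability.
    grow : ∀ {W} → Acc _⊃_ W → x ∈ W → (∀ {y} → y ∈ W → Star R x y) → ∀ y → Dec (Star R x y)
    grow {W} (acc rec) x∈W sound y
      with any? (λ a → any? (λ b → (a ∈? W) ×-dec R? a b ×-dec ¬? (b ∈? W)))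
    ... | yes (a , b , a∈W , aRb , b∉W) =
      grow (rec (p⊂p∪⁅x⁆ b∉W)) (p⊆p∪q ⁅ b ⁆ x∈W)
        (λ z∈ → [ sound , (λ { refl → sound a∈W ◅◅ return aRb }) ]′ (x∈p∪⁅y⁆⁻ W z∈)) y
    ... | no closed = map′ sound (λ s → complete s x∈W) (y ∈? W)
      where
      complete : ∀ {a b} → Star R a b → a ∈ W → b ∈ W
      complete ε a∈W = a∈W
      complete {a} (_◅_ {j = c} r s) a∈W = complete s
        (decidable-stable (c ∈? W) (λ c∉W → closed (a , c , a∈W , r , c∉W)))

  Star? : ∀ y → Dec (Star R x y)
  Star? = grow (⊃-wellFounded _) (x∈⁅x⁆ x) (λ y∈ → subst (Star R x) (sym (x∈⁅y⁆⇒x≡y x y∈)) ε)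

-- Exchanging one blue vertex for another.

exchange : Subset n → Fin n → Fin n → Subset n
exchange B u w = (B - u) ∪ ⁅ w ⁆

module _ {B : Subset n} {u w : Fin n} where

  w∈exchange : w ∈ exchange B u w
  w∈exchange = x∈p∪⁅x⁆ (B - u) w

  ∈-exchange⁺ : ∀ {x} → x ∈ B → x ≢ u → x ∈ exchange B u w
  ∈-exchange⁺ x∈B x≢u = p⊆p∪q ⁅ w ⁆ (x∈p∧x≢y⇒x∈p-y x∈B x≢u)

  ∈-exchange⁻ : ∀ {x} → x ∈ exchange B u w → (x ∈ B × x ≢ u) ⊎ x ≡ w
  ∈-exchange⁻ x∈ with x∈p∪⁅y⁆⁻ (B - u) x∈
  ... | inj₁ x∈B-u = inj₁ (p─q⊆p B ⁅ u ⁆ x∈B-u , λ { refl → x∉p-x B u x∈B-u })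
  ... | inj₂ x≡w   = inj₂ x≡w

  ∉-exchange⇒≡ : ∀ {x} → x ∉ exchange B u w → x ∈ B → x ≡ u
  ∉-exchange⇒≡ {x} x∉ x∈B = decidable-stable (x ≟ u) (x∉ ∘ ∈-exchange⁺ x∈B)

  ∪⁅⁆⊆exchange∪⁅⁆ : B ∪ ⁅ w ⁆ ⊆ exchange B u w ∪ ⁅ u ⁆
  ∪⁅⁆⊆exchange∪⁅⁆ = ∪⁅⁆-least old (p⊆p∪q ⁅ u ⁆ w∈exchange)
    where
    old : B ⊆ exchange B u w ∪ ⁅ u ⁆
    old {x} x∈B with x ≟ u
    ... | yes refl = x∈p∪⁅x⁆ (exchange B u w) u
    ... | no x≢u   = p⊆p∪q ⁅ u ⁆ (∈-exchange⁺ x∈B x≢u)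

  ∣exchange∣ : u ∈ B → w ∉ B → ∣ exchange B u w ∣ ≡ ∣ B ∣
  ∣exchange∣ u∈B w∉B =
    trans (∣p∪⁅x⁆∣≡1+∣p∣ (B - u) (w∉B ∘ p─q⊆p B ⁅ u ⁆)) (sym (∣p∣≡1+∣p-x∣ u∈B))

InjectiveOn : (Fin n → Fin n) → Pred (Subset n) 0ℓ
InjectiveOn c B = ∀ {x y} → x ∈ B → y ∈ B → c x ≡ c y → x ≡ y

-- `w` inherits the colour of `u`, which only `u` had in `B` and which its removal frees.
InjectiveOn-exchange : ∀ {c} {B : Subset n} {u w} → u ∈ B → c u ≡ c w → InjectiveOn c B →
                       InjectiveOn c (exchange B u w)
InjectiveOn-exchange {B = B} u∈B cu≡cw inj x∈ y∈ cx≡cy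
  with ∈-exchange⁻ {B = B} x∈ | ∈-exchange⁻ {B = B} y∈
... | inj₁ (x∈B , _)   | inj₁ (y∈B , _)   = inj x∈B y∈B cx≡cy
... | inj₁ (x∈B , x≢u) | inj₂ refl        = contradiction (inj x∈B u∈B (trans cx≡cy (sym cu≡cw))) x≢u
... | inj₂ refl        | inj₁ (y∈B , y≢u) = contradiction (inj y∈B u∈B (trans (sym cx≡cy) (sym cu≡cw))) y≢u
... | inj₂ refl        | inj₂ refl        = refl

-- Components of G - B and valid forces.

module _ (G : Graph n) where
  open Graph G

  private
    Adj : Subset n → Rel (Fin n) 0ℓ
    Adj B = E (delete G B)

  Adj-antitone : ∀ {B B′ x y} → B ⊆ B′ → Star (Adj B′) x y → Star (Adj B) x y
  Adj-antitone B⊆B′ = Star.map (λ (x∉ , y∉ , xy) → x∉ ∘ B⊆B′ , y∉ ∘ B⊆B′ , xy)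

  component-∉ : ∀ {B x y} → x ∉ B → Star (Adj B) x y → y ∉ B
  component-∉ x∉B ε                     = x∉B
  component-∉ x∉B ((_ , y∉B , _) ◅ s) = component-∉ y∉B s

  -- Every vertex of a walk from `x` in G - B lies in the component of `x`; if that component avoids
  -- `D`, the same walk survives in G - D.
  component-stable : ∀ {B D x} → (∀ {y} → Star (Adj B) x y → y ∉ D) →
                     ∀ {y} → Star (Adj B) x y → Star (Adj D) x y
  component-stable disjoint ε = ε
  component-stable disjoint (e@(_ , _ , xy) ◅ s) =
    (disjoint ε , disjoint (return e) , xy) ◅ component-stable (disjoint ∘ (e ◅_)) s

  component-sym : ∀ {B x y} → Star (Adj B) x y → Star (Adj B) y x
  component-sym {B} = reverse (Subgraph.E-sym (delete G B))

  Adj? : ∀ B → Decidable (Adj B)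
  Adj? B x y = ¬? (x ∈? B) ×-dec ¬? (y ∈? B) ×-dec (y ∈? N x)

  -- The target `w` itself serves as the representative of its component.
  S₊⁺ : ∀ {B u w} → u ∈ B → w ∉ B → w ∈ N u →
        (∀ {y} → y ∈ N u → Star (Adj B) w y → y ≡ w) → S₊ G B u w
  S₊⁺ {w = w} u∈B w∉B uw only =
    u∈B , w , w∉B , (λ (uy , wy) → sym (only uy wy)) , (λ { refl → uw , ε })

  S₊-source : ∀ {B u w} → S₊ G B u w → u ∈ B
  S₊-source (u∈B , _) = u∈B

  S₊-target : ∀ {B u w} → S₊ G B u w → w ∉ B
  S₊-target (_ , _ , x∉B , _ , valid) = component-∉ x∉B (proj₂ (valid refl))

  S₊-adjacent : ∀ {B u w} → S₊ G B u w → w ∈ N u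
  S₊-adjacent (_ , _ , _ , _ , valid) = proj₁ (valid refl)

  S₊-only : ∀ {B u w} → S₊ G B u w → ∀ {y} → y ∈ N u → Star (Adj B) w y → y ≡ w
  S₊-only (_ , _ , _ , only , valid) uy wy = sym (only (uy , proj₂ (valid refl) ◅◅ wy))

  -- More blue vertices only shrink the component of `w`, so `u` gains no further neighbour in it.
  S₊-mono : ∀ {B B′ u w} → B ⊆ B′ → w ∉ B′ → S₊ G B u w → S₊ G B′ u w
  S₊-mono B⊆B′ w∉B′ s =
    S₊⁺ (B⊆B′ (S₊-source s)) w∉B′ (S₊-adjacent s)
        (λ uy wy → S₊-only s uy (Adj-antitone B⊆B′ wy))

  S₊-reverse : ∀ {B u w} → S₊ G B u w → S₊ G (exchange B u w) w u
  S₊-reverse {B} {u} {w} s = S₊⁺ w∈B′ u∉B′ (symmetric (S₊-adjacent s)) only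
    where
    B′ = exchange B u w

    w∈B′ : w ∈ B′
    w∈B′ = w∈exchange {B = B}

    u∉B′ : u ∉ B′
    u∉B′ u∈B′ with ∈-exchange⁻ u∈B′
    ... | inj₁ (_ , u≢u) = u≢u refl
    ... | inj₂ refl      = S₊-target s (S₊-source s)

    -- Invariant of a walk from `u` in G - B′: apart from `u` itself, it stays out of the component
    -- of `w` in G - B.
    Separated : Pred (Fin n) 0ℓ
    Separated z = z ≢ u → ¬ Star (Adj B) w z

    separated : ∀ {z y} → Separated z → Star (Adj B′) z y → Separated y
    separated sep ε = sep
    separated {z} sep (_◅_ {j = x} (z∉B′ , x∉B′ , zx) r) = separated sep′ r
      where
      sep′ : Separated x
      sep′ x≢u wx with z ≟ u
      -- The walk leaves `u`: its only neighbour in the old component is `w`, which is blue in `B′`.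
      ... | yes refl = x∉B′ (subst (_∈ B′) (sym (S₊-only s zx wx)) w∈B′)
      ... | no z≢u   = sep z≢u (wx ◅◅ return
        (x≢u ∘ ∉-exchange⇒≡ x∉B′ , z≢u ∘ ∉-exchange⇒≡ z∉B′ , symmetric zx))

    only : ∀ {y} → y ∈ N w → Star (Adj B′) u y → y ≡ u
    -- Another such `y` would be white for `B` and adjacent to `w`, hence in the old component of
    -- `w`, against the invariant.
    only {y} wy uy = decidable-stable (y ≟ u) λ y≢u →
      separated (λ u≢u → ⊥-elim (u≢u refl)) uy y≢u
        (return (S₊-target s , y≢u ∘ ∉-exchange⇒≡ (component-∉ u∉B′ uy) , wy))

  -- Only `u` turns white, so a new walk could leave the old component only through `u`. Its one
  -- neighbour there is `w`, which the exchange makes blue.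
  component-exchange : ∀ {B u w} → S₊ G B u w → ∀ {x y} → x ∉ B → Star (Adj B) w x →
                       Star (Adj (exchange B u w)) x y → Star (Adj B) x y
  component-exchange s x∉B wx ε = ε
  component-exchange {B} {u} {w} s {x} x∉B wx (_◅_ {j = z} (x∉B′ , z∉B′ , xz) r) =
    e ◅ component-exchange s z∉B (wx ◅◅ return e) r
    where
    z∉B : z ∉ B
    z∉B z∈B with ∉-exchange⇒≡ z∉B′ z∈B
    ... | refl = x∉B′ (subst (_∈ exchange B u w) (sym (S₊-only s (symmetric xz) wx)) (w∈exchange {B = B}))

    e : Adj B x z
    e = x∉B , z∉B , xz

  -- Colour-preserving forcing, one vertex at a time.

  data Forcing (c : Fin n → Fin n) : Pred (Subset n) 0ℓ where
    done : Forcing c ⊤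
    step : ∀ {B u w} → S₊ G B u w → c u ≡ c w → Forcing c (B ∪ ⁅ w ⁆) → Forcing c B

  module _ {c : Fin n → Fin n} where

    -- Forces whose target is already blue are skipped; the others stay valid by `S₊-mono`.
    Forcing-mono : ∀ {B B′} → B ⊆ B′ → Forcing c B → Forcing c B′
    Forcing-mono ⊤⊆B′ done = subst (Forcing c) (⊆-antisym ⊤⊆B′ (⊆-max _)) done
    Forcing-mono {B′ = B′} B⊆B′ (step {w = w} s cu≡cw f) with w ∈? B′
    ... | yes w∈B′ = Forcing-mono (∪⁅⁆-least B⊆B′ w∈B′) f
    ... | no w∉B′  = step (S₊-mono B⊆B′ w∉B′ s) cu≡cw
      (Forcing-mono (∪⁅⁆-least (p⊆p∪q ⁅ w ⁆ ∘ B⊆B′) (x∈p∪⁅x⁆ B′ w)) f)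

    -- Serialises a time-step: forces valid together for `B` can be done in any order, as each stays
    -- valid until its target is blue.
    Forcing-simultaneous : ∀ {B D} →
      (∀ {x} → x ∈ D → x ∉ B → ∃[ u ] (S₊ G B u x × c u ≡ c x)) →
      Forcing c D → Forcing c B
    Forcing-simultaneous {B} = go (⊃-wellFounded B)
      where
      go : ∀ {B D} → Acc _⊃_ B →
           (∀ {x} → x ∈ D → x ∉ B → ∃[ u ] (S₊ G B u x × c u ≡ c x)) →
           Forcing c D → Forcing c B
      go {B} {D} (acc rec) forced f with any? (λ x → (x ∈? D) ×-dec ¬? (x ∈? B))
      ... | no none = Forcing-mono
        (λ {x} x∈D → decidable-stable (x ∈? B) (λ x∉B → none (x , x∈D , x∉B))) f
      ... | yes (x , x∈D , x∉B) with forced x∈D x∉B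
      ...   | u , s , cu≡cx = step s cu≡cx (go (rec (p⊂p∪⁅x⁆ x∉B)) forced′ f)
        where
        forced′ : ∀ {y} → y ∈ D → y ∉ B ∪ ⁅ x ⁆ → ∃[ v ] (S₊ G (B ∪ ⁅ x ⁆) v y × c v ≡ c y)
        forced′ y∈D y∉ with forced y∈D (y∉ ∘ p⊆p∪q ⁅ x ⁆)
        ... | v , t , cv≡cy = v , S₊-mono (p⊆p∪q ⁅ x ⁆) y∉ t , cv≡cy

    Forcing⇒IsPSDForcingSet : ∀ {B} → Forcing c B → IsPSDForcingSet G B
    Forcing⇒IsPSDForcingSet done         = ε
    Forcing⇒IsPSDForcingSet (step s _ f) = (_ , _ , s , refl) ◅ Forcing⇒IsPSDForcingSet f

    -- Induction along the forcing. If the first target `w` lies outside the component of `v`, the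
    -- force found for `B ∪ ⁅ w ⁆` is pulled back to `B`.
    force-into-component : ∀ {B v} → Forcing c B → v ∉ B →
      ∃[ u ] ∃[ w ] (S₊ G B u w × c u ≡ c w × Star (Adj B) v w)
    force-into-component done v∉B = contradiction ∈⊤ v∉B
    force-into-component {B} {v} (step {u = u} {w} s cu≡cw f) v∉B with Star? (Adj? B) v w
    ... | yes vw = u , w , s , cu≡cw , vw
    ... | no ¬vw with force-into-component f (avoids ε)
      where
      avoids : ∀ {y} → Star (Adj B) v y → y ∉ B ∪ ⁅ w ⁆
      avoids vy y∈ with x∈p∪⁅y⁆⁻ B y∈
      ... | inj₁ y∈B  = component-∉ v∉B vy y∈B
      ... | inj₂ refl = ¬vw vy
    ...   | u′ , w′ , s′ , cu′≡cw′ , vw′ = u′ , w′ , S₊⁺ u′∈B w′∉B (S₊-adjacent s′) only , cu′≡cw′ , vw′ᴮ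
      where
      vw′ᴮ : Star (Adj B) v w′
      vw′ᴮ = Adj-antitone (p⊆p∪q ⁅ w ⁆) vw′

      w′∉B : w′ ∉ B
      w′∉B = component-∉ v∉B vw′ᴮ

      u′∈B : u′ ∈ B
      u′∈B with x∈p∪⁅y⁆⁻ B (S₊-source s′)
      ... | inj₁ u′∈B = u′∈B
      -- If `u′` were `w`, the edge from `w′` to `w` would put `w` into the component of `v`.
      ... | inj₂ refl = ⊥-elim (¬vw (vw′ᴮ ◅◅ return (w′∉B , S₊-target s , symmetric (S₊-adjacent s′))))

      avoids : ∀ {y} → Star (Adj B) w′ y → y ∉ B ∪ ⁅ w ⁆
      avoids w′y y∈ with x∈p∪⁅y⁆⁻ B y∈
      ... | inj₁ y∈B  = component-∉ w′∉B w′y y∈B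
      ... | inj₂ refl = ¬vw (vw′ᴮ ◅◅ w′y)

      only : ∀ {y} → y ∈ N u′ → Star (Adj B) w′ y → y ≡ w′
      only u′y w′y = S₊-only s′ u′y (component-stable avoids w′y)

    Forcing-exchange : ∀ {B u w} → S₊ G B u w → c u ≡ c w → Forcing c B →
                       Forcing c (exchange B u w)
    Forcing-exchange {B} {u} {w} s cu≡cw f = step (S₊-reverse s) (sym cu≡cw)
      (Forcing-mono (∪⁅⁆⊆exchange∪⁅⁆ ∘ p⊆p∪q {p = B} ⁅ w ⁆) f)

    move-to : ∀ v {B} → InjectiveOn c B → Forcing c B →
      ∃[ B′ ] (v ∈ B′ × ∣ B′ ∣ ≡ ∣ B ∣ × InjectiveOn c B′ × Forcing c B′)
    move-to v inj f = go (⊂-wellFounded ⊤) (λ _ _ → ∈⊤) inj f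
      where
      -- `W` contains all white vertices reachable from `v` in G - B. It stands in for the component
      -- of `v` as termination measure and loses `w` at each exchange.
      go : ∀ {W B} → Acc _⊂_ W → (∀ {y} → Star (Adj B) v y → y ∉ B → y ∈ W) →
           InjectiveOn c B → Forcing c B →
           ∃[ B′ ] (v ∈ B′ × ∣ B′ ∣ ≡ ∣ B ∣ × InjectiveOn c B′ × Forcing c B′)
      go {W} {B} (acc rec) bound inj f with v ∈? B
      ... | yes v∈B = B , v∈B , refl , inj , f
      ... | no v∉B with force-into-component f v∉B
      ...   | u , w , s , cu≡cw , vw
            with go (rec (x∈p⇒p-x⊂p (bound vw (S₊-target s)))) bound′
                    (InjectiveOn-exchange (S₊-source s) cu≡cw inj)
                    (Forcing-exchange s cu≡cw f)
        where
        bound′ : ∀ {y} → Star (Adj (exchange B u w)) v y → y ∉ exchange B u w → y ∈ W - w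
        bound′ vy y∉B′ = x∈p∧x≢y⇒x∈p-y (bound vyᴮ (component-∉ v∉B vyᴮ))
                                       (λ { refl → y∉B′ (w∈exchange {B = B}) })
          where vyᴮ = component-exchange s v∉B (component-sym vw) vy
      ...     | B′ , v∈B′ , size , inj′ , f′ =
        B′ , v∈B′ , trans size (∣exchange∣ (S₊-source s) (S₊-target s)) , inj′ , f′

  -- The colouring of a relaxed chronology by roots.

  module _ {B : Subset n} (C : RelaxedChronology G B) where
    open RelaxedChronology C hiding (forcingTreeCover)

    private
      blue-zero : blue 0 ≡ B
      blue-zero = ∪-identityʳ B

      blue-suc : ∀ i → blue (suc (toℕ i)) ≡ blue (toℕ i) ∪ targets (lookup forces i)
      blue-suc i = trans (cong (B ∪_) (⋃-take-suc targets forces i)) (sym (∪-assoc B _ _))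

    descend : (Q : Pred (Subset n) 0ℓ) → Q ⊤ →
              (∀ i → Q (blue (toℕ i) ∪ targets (lookup forces i)) → Q (blue (toℕ i))) → Q B
    descend Q Q⊤ pred = subst Q blue-zero
      -- The index runs over the K + 1 times from K down to 0; `inject₁ i` and `suc i` are the times
      -- before and after position `i`.
      (>-weakInduction (Q ∘ blue ∘ toℕ)
        (subst Q (sym (trans (cong blue (toℕ-fromℕ (length forces))) complete)) Q⊤)
        (λ i q → subst (Q ∘ blue) (sym (toℕ-inject₁ i)) (pred i (subst Q (blue-suc i) q)))
        zero)

    ascend : (Q : Pred (Subset n) 0ℓ) → Q B →
             (∀ i → Q (blue (toℕ i)) → Q (blue (toℕ i) ∪ targets (lookup forces i))) → Q ⊤
    -- Forward induction is backward induction on "from here, `Q` reaches `⊤`".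
    ascend Q QB next = descend (λ X → Q X → Q ⊤) id (λ i f → f ∘ next i) QB

    root : ∀ x → ∃[ b ] (b ∈ B × Star Force b x)
    root x = ascend Rooted (λ b∈B → _ , b∈B , ε) next ∈⊤
      where
      Rooted : Pred (Subset n) 0ℓ
      Rooted X = ∀ {x} → x ∈ X → ∃[ b ] (b ∈ B × Star Force b x)

      next : ∀ i → Rooted (blue (toℕ i)) → Rooted (blue (toℕ i) ∪ targets (lookup forces i))
      next i rooted x∈ with x∈p∪q⁻ (blue (toℕ i)) _ x∈
      ... | inj₁ x∈blue = rooted x∈blue
      ... | inj₂ x∈F with targets⁻ (lookup forces i) x∈F
      ...   | v , v→x with rooted (S₊-source (valid i v→x))
      ...     | b , b∈B , bv = b , b∈B , bv ◅◅ return (lookup forces i , ∈-lookup i , v→x)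

    Force-index : ∀ {v u} → Force v u → ∃[ i ] u ∈ lookup forces i v
    Force-index {v} {u} (F , F∈ , v→u) =
      Any.index F∈ , subst (λ F → u ∈ F v) (lookup-index F∈) v→u

    Force-target : ∀ {v u} → Force v u → u ∉ B
    Force-target force u∈B with Force-index force
    ... | i , v→u = S₊-target (valid i v→u) (p⊆p∪q _ u∈B)

    -- Within one time-step this is `unique`; across two, the earlier force has made `u` blue, so
    -- the later one is not valid.
    Force-unique : ∀ {v v′ u} → Force v u → Force v′ u → v ≡ v′
    Force-unique force force′ with Force-index force | Force-index force′
    ... | i , v→u | j , v′→u with <-cmp i j
    ...   | tri≈ _ refl _ = unique i v→u v′→u
    ...   | tri< i<j _ _  = contradiction
      (q⊆p∪q B _ (lookup⊆⋃-take targets forces i<j (targets⁺ (lookup forces i) v→u)))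
      (S₊-target (valid j v′→u))
    ...   | tri> _ _ j<i  = contradiction
      (q⊆p∪q B _ (lookup⊆⋃-take targets forces j<i (targets⁺ (lookup forces j) v′→u)))
      (S₊-target (valid i v→u))

    -- Traced backwards from `x`, the two chains agree: a vertex has at most one forcer, and
    -- vertices of `B` have none.
    root-unique : ∀ {b b′ x} → b ∈ B → b′ ∈ B → Star Force b x → Star Force b′ x → b ≡ b′
    root-unique b∈B b′∈B bx b′x = go b∈B b′∈B (reverse id bx) (reverse id b′x)
      where
      go : ∀ {b b′ x} → b ∈ B → b′ ∈ B → Star (flip Force) x b → Star (flip Force) x b′ → b ≡ b′
      go _   _    ε       ε       = refl
      go b∈B _    ε       (f ◅ _) = contradiction b∈B (Force-target f)
      go _   b′∈B (f ◅ _) ε       = contradiction b′∈B (Force-target f)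
      go b∈B b′∈B (f ◅ r) (f′ ◅ r′) with Force-unique f f′
      ... | refl = go b∈B b′∈B r r′

    colour : Fin n → Fin n
    colour x = proj₁ (root x)

    Force⇒colour-≡ : ∀ {v u} → Force v u → colour v ≡ colour u
    Force⇒colour-≡ {v} {u} force with root v | root u
    ... | b , b∈B , bv | b′ , b′∈B , b′u = root-unique b∈B b′∈B (bv ◅◅ return force) b′u

    colour-injective : InjectiveOn colour B
    colour-injective x∈B y∈B cx≡cy = trans (sym (fixes x∈B)) (trans cx≡cy (fixes y∈B))
      where
      fixes : ∀ {x} → x ∈ B → colour x ≡ x
      fixes {x} x∈B with root x
      ... | b , b∈B , bx = root-unique b∈B x∈B bx ε

    colour-forcing : Forcing colour B
    colour-forcing = descend (Forcing colour) done (λ i → Forcing-simultaneous (forced i))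
      where
      forced : ∀ i {x} → x ∈ blue (toℕ i) ∪ targets (lookup forces i) → x ∉ blue (toℕ i) →
               ∃[ u ] (S₊ G (blue (toℕ i)) u x × colour u ≡ colour x)
      forced i x∈ x∉ with x∈p∪q⁻ (blue (toℕ i)) _ x∈
      ... | inj₁ x∈blue = contradiction x∈blue x∉
      ... | inj₂ x∈F with targets⁻ (lookup forces i) x∈F
      ...   | v , v→x = v , valid i v→x , Force⇒colour-≡ (lookup forces i , ∈-lookup i , v→x)

  -- Forcing trees as colour classes.

  ≈-induced-resp : ∀ (H : Subgraph G) {P Q : Pred (Fin n) 0ℓ} → P ≐ Q →
                   H ≈ induced G P → H ≈ induced G Q
  ≈-induced-resp H P≐Q@(P⊆Q , Q⊆P) (V≐P , E⇒ , E⇐) =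
    ≐-trans V≐P P≐Q ,
    (λ e → let (x , y , xy) = E⇒ e in P⊆Q x , P⊆Q y , xy) ,
    (λ (x , y , xy) → E⇐ (Q⊆P x , Q⊆P y , xy))

  colourClasses : (Fin n → Fin n) → Pred (Subgraph G) 0ℓ
  colourClasses c H = ∃[ x ] H ≈ induced G (λ y → c x ≡ c y)

  module _ {c B} (C : RelaxedChronology G B) (inj : InjectiveOn c B)
           (preserves : ∀ {v u} → RelaxedChronology.Force C v u → c v ≡ c u) where
    open RelaxedChronology C using (Force; forcingTree)

    private
      Star-preserves : ∀ {v u} → Star Force v u → c v ≡ c u
      Star-preserves = Star.fold (λ v u → c v ≡ c u) (λ f → trans (preserves f)) refl

    -- Forces keep the colour, so the tree lies in the class. Conversely, the root of a vertex of
    -- the class has the colour of `b`, hence is `b` by injectivity.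
    tree≐class : ∀ {b x} → b ∈ B → c x ≡ c b → Star Force b ≐ (λ y → c x ≡ c y)
    tree≐class {b} {x} b∈B cx≡cb = (λ by → trans cx≡cb (Star-preserves by)) , class⊆tree
      where
      class⊆tree : ∀ {y} → c x ≡ c y → Star Force b y
      class⊆tree {y} cx≡cy with root C y
      ... | b′ , b′∈B , b′y with inj b′∈B b∈B (trans (Star-preserves b′y) (trans (sym cx≡cy) cx≡cb))
      ...   | refl = b′y

    forcingTreeCover≐colourClasses : forcingTreeCover C ≐ colourClasses c
    forcingTreeCover≐colourClasses = (λ {H} → to H) , (λ {H} → from H)
      where
      to : ∀ H → forcingTreeCover C H → colourClasses c H
      to H (b , b∈B , H≈) = b , ≈-induced-resp H (tree≐class b∈B refl) H≈

      from : ∀ H → colourClasses c H → forcingTreeCover C H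
      from H (x , H≈) with root C x
      ... | b , b∈B , bx =
        b , b∈B , ≈-induced-resp H (≐-sym (tree≐class b∈B (sym (Star-preserves bx)))) H≈

  -- From a forcing sequence to a relaxed chronology.

  module _ {B : Subset n} {u w : Fin n} (s : S₊ G B u w) where

    private
      single : ForceSet n
      single v with v ≟ u
      ... | yes _ = ⁅ w ⁆
      ... | no _  = ⊥

    single⁻ : ∀ {v x} → x ∈ single v → v ≡ u × x ≡ w
    single⁻ {v} x∈ with v ≟ u
    ... | yes v≡u = v≡u , x∈⁅y⁆⇒x≡y w x∈
    ... | no _    = ⊥-elim (∉⊥ x∈)

    w∈single : w ∈ single u
    w∈single with u ≟ u
    ... | yes _  = x∈⁅x⁆ w
    ... | no u≢u = ⊥-elim (u≢u refl)

    targets-single : targets single ≡ ⁅ w ⁆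
    targets-single = ⊆-antisym
      (λ x∈ → subst (_∈ ⁅ w ⁆) (sym (single-only x∈)) (x∈⁅x⁆ w))
      (λ x∈ → subst (_∈ targets single) (sym (x∈⁅y⁆⇒x≡y w x∈)) (targets⁺ single {u} w∈single))
      where
      single-only : ∀ {x} → x ∈ targets single → x ≡ w
      single-only x∈ with targets⁻ single x∈
      ... | v , v→x = proj₂ (single⁻ {v} v→x)

    prepend : RelaxedChronology G (B ∪ ⁅ w ⁆) → RelaxedChronology G B
    prepend C = record
      { forces   = single ∷ forces
      ; valid    = valid′
      ; unique   = unique′
      ; complete = trans (blue-suc (length forces)) complete
      }
      where
      open RelaxedChronology C
      -- After the singleton step the blue set is `B ∪ ⁅ w ⁆`, so time k + 1 of the new chronology
      -- is time k of `C`.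
      blue-suc : ∀ k → B ∪ (targets single ∪ ⋃ (map targets (take k forces))) ≡ blue k
      blue-suc k = trans (cong (λ p → B ∪ (p ∪ _)) targets-single) (sym (∪-assoc B ⁅ w ⁆ _))

      valid′ : ∀ (i : Fin (suc (length forces))) {v x} → x ∈ lookup (single ∷ forces) i v →
               S₊ G (B ∪ ⋃ (map targets (take (toℕ i) (single ∷ forces)))) v x
      valid′ zero {v} v→x with single⁻ {v} v→x
      ... | refl , refl = subst (λ p → S₊ G p u w) (sym (∪-identityʳ B)) s
      valid′ (suc i) {v} {x} v→x =
        subst (λ p → S₊ G p v x) (sym (blue-suc (toℕ i))) (valid i v→x)

      unique′ : ∀ (i : Fin (suc (length forces))) {v₁ v₂ x} →
                x ∈ lookup (single ∷ forces) i v₁ → x ∈ lookup (single ∷ forces) i v₂ → v₁ ≡ v₂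
      unique′ zero {v₁} {v₂} v₁→x v₂→x = trans (proj₁ (single⁻ {v₁} v₁→x)) (sym (proj₁ (single⁻ {v₂} v₂→x)))
      unique′ (suc i) v₁→x v₂→x = unique i v₁→x v₂→x

  chronology : ∀ {c B} → Forcing c B →
    Σ[ C ∈ RelaxedChronology G B ] (∀ {v u} → RelaxedChronology.Force C v u → c v ≡ c u)
  chronology done = record
    { forces   = []
    ; valid    = λ ()
    ; unique   = λ ()
    ; complete = ∪-identityʳ ⊤
    } , λ { (_ , () , _) }
  chronology {c} (step {u = u} {w} s cu≡cw f) with chronology f
  ... | C , preserves = prepend s C , preserves′
    where
    preserves′ : ∀ {v x} → RelaxedChronology.Force (prepend s C) v x → c v ≡ c x
    preserves′ {v} (_ , here refl , v→x) with single⁻ s {v} v→x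
    ... | refl , refl = cu≡cw
    preserves′ (F , there F∈ , v→x) = preserves (F , F∈ , v→x)

corollary5p12 : ∀ {n : ℕ} (G : Graph n) (k : ℕ) (𝒯 : Pred (Subgraph G) 0ℓ) →
    (Σ[ B₀ ∈ Subset n ]
    (IsPSDForcingSet G B₀ × ∣ B₀ ∣ ≡ k ×
    Σ[ C₀ ∈ RelaxedChronology G B₀ ] 𝒯 ≐ forcingTreeCover C₀)) →
    ∀ (v : Fin n) →
    Σ[ B ∈ Subset n ]
    (IsPSDForcingSet G B × ∣ B ∣ ≡ k × v ∈ B ×
    Σ[ C ∈ RelaxedChronology G B ] 𝒯 ≐ forcingTreeCover C)
corollary5p12 G k 𝒯 (B₀ , _ , size₀ , C₀ , 𝒯≐) v
  with move-to G v (colour-injective G C₀) (colour-forcing G C₀)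
... | B , v∈B , size , inj , f with chronology G f
...   | C , preserves =
  B , Forcing⇒IsPSDForcingSet G f , trans size size₀ , v∈B , C ,
  -- Both covers consist of the classes of one colouring, that of `C₀`.
  ≐-trans 𝒯≐ (≐-trans
    (forcingTreeCover≐colourClasses G C₀ (colour-injective G C₀) (Force⇒colour-≡ G C₀))
    (≐-sym (forcingTreeCover≐colourClasses G C inj preserves)))
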